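{- Let $G$ be a finite simple graph with independence number at most $2$. If the complement $\overline{G}$ is homomorphic to the Andrásfai graph $\Gamma_d$ for some $d\in\mathbb{N}$, then $G$ contains a strong immersion of $K_{\chi(G)}$.
   Context: A homomorphism from a graph $G$ to a graph $H$ is a map $h\colon V(G)\to V(H)$ with $h(u)h(v)\in E(H)$ for every $uv\in E(G)$. For $d\in\mathbb{N}$, $\Gamma_d$ has vertex set $[3d-1]$ and edge set $\{xy : y = x+i \text{ for some } i\in\{d,\dots,2d-1\}\}$, arithmetic modulo $3d-1$. An immersion of a graph $H$ in a graph $G$ is a minimal subgraph $I$ of $G$ for which there is an injection $\mathrm{i}\colon V(H)\to V(I)$ and a set of pairwise edge-disjoint paths $\{P_e : e\in E(H)\}$ in $I$ such that the end vertices of $P_{uv}$ are precisely $\mathrm{i}(u)$ and $\mathrm{i}(v)$; the image of $\mathrm{i}$ is the set of branch vertices, and the immersion is strong if no internal vertex of any path $P_e$ is a branch vertex. $\chi(G)$ is the chromatic number. -}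

module Defs where

open import Data.Nat using (ℕ; zero; suc; _+_; _*_; _∸_; _≤_; _<_)
open import Data.Fin using (Fin; toℕ)
open import Data.Product using (Σ; _×_; _,_; ∃; ∃-syntax)
open import Data.Sum using (_⊎_)
open import Data.List using (List; []; _∷_; length)
open import Data.List.Membership.Propositional using (_∈_)
open import Data.List.Relation.Unary.Unique.Propositional using (Unique)
open import Data.Maybe using (Maybe; just)
open import Function.Definitions using (Injective)
open import Relation.Binary.PropositionalEquality using (_≡_; _≢_)
open import Relation.Nullary using (¬_)
open import Relation.Binary.Definitions using (Decidable)

record Graph (n : ℕ) : Set₁ where
  field
    Adj    : Fin n → Fin n → Set
    adj?   : Decidable Adj
    sym    : ∀ {u v} → Adj u v → Adj v u
    irrefl : ∀ {u} → ¬ Adj u u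
open Graph public

ComplAdj : ∀ {n} → Graph n → Fin n → Fin n → Set
ComplAdj G u v = u ≢ v × ¬ Adj G u v

Independent : ∀ {n} → Graph n → List (Fin n) → Set
Independent G S = Unique S × (∀ {u v} → u ∈ S → v ∈ S → ¬ Adj G u v)

IndependenceNumberAtMost : ∀ {n} → Graph n → ℕ → Set
IndependenceNumberAtMost G k = ∀ S → Independent G S → length S ≤ k

-- Andrásfai graph Γ_d on vertex set Fin (3d-1):
-- x ~ y iff y ≡ x + i (mod 3d-1) for some i ∈ {d, …, 2d-1}.
-- Since toℕ y < 3d-1, "y = (x + i) mod (3d-1)" unfolds to x + i = y + q(3d-1).
AndrasfaiAdj : (d : ℕ) → Fin (3 * d ∸ 1) → Fin (3 * d ∸ 1) → Set
AndrasfaiAdj d x y =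
  ∃[ i ] (d ≤ i × i < 2 * d × ∃[ q ] (toℕ x + i ≡ toℕ y + q * (3 * d ∸ 1)))

ComplHomToAndrasfai : ∀ {n} → Graph n → ℕ → Set
ComplHomToAndrasfai {n} G d =
  Σ (Fin n → Fin (3 * d ∸ 1)) λ h →
    ∀ {u v} → ComplAdj G u v → AndrasfaiAdj d (h u) (h v)

ProperColouring : ∀ {n} → Graph n → (k : ℕ) → (Fin n → Fin k) → Set
ProperColouring G k c = ∀ {u v} → Adj G u v → c u ≢ c v

Colourable : ∀ {n} → Graph n → ℕ → Set
Colourable {n} G k = Σ (Fin n → Fin k) (ProperColouring G k)

IsChromaticNumber : ∀ {n} → Graph n → ℕ → Set
IsChromaticNumber G k = Colourable G k × (∀ j → Colourable G j → k ≤ j)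

head? : ∀ {A : Set} → List A → Maybe A
head? []      = Data.Maybe.nothing
head? (x ∷ _) = just x

last? : ∀ {A : Set} → List A → Maybe A
last? []           = Data.Maybe.nothing
last? (x ∷ [])     = just x
last? (_ ∷ y ∷ ys) = last? (y ∷ ys)

IsWalk : ∀ {n} → Graph n → List (Fin n) → Set
IsWalk G []           = Data.Unit.⊤ where import Data.Unit
IsWalk G (x ∷ [])     = Data.Unit.⊤ where import Data.Unit
IsWalk G (x ∷ y ∷ ys) = Adj G x y × IsWalk G (y ∷ ys)

IsPath : ∀ {n} → Graph n → Fin n → Fin n → List (Fin n) → Set
IsPath G a b p = head? p ≡ just a × last? p ≡ just b × IsWalk G p × Unique p

steps : ∀ {A : Set} → List A → List (A × A)
steps []           = []
steps (x ∷ [])     = []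
steps (x ∷ y ∷ ys) = (x , y) ∷ steps (y ∷ ys)

UsesEdge : ∀ {n} → List (Fin n) → Fin n → Fin n → Set
UsesEdge p a b = (a , b) ∈ steps p ⊎ (b , a) ∈ steps p

EdgeDisjoint : ∀ {n} → List (Fin n) → List (Fin n) → Set
EdgeDisjoint p q = ∀ a b → UsesEdge p a b → ¬ UsesEdge q a b

Internal : ∀ {n} → Fin n → Fin n → List (Fin n) → Fin n → Set
Internal a b p x = x ∈ p × x ≢ a × x ≢ b

-- G contains a strong immersion of K_k: an injection ι of the vertices of K_k,
-- and for every edge uv (u < v) of K_k a path P u v from ι u to ι v,
-- pairwise edge-disjoint, with no branch vertex internal to any path.
-- (Minimality of the subgraph I is irrelevant for containment: take I = union of the paths.)
StrongImmersionOfComplete : ∀ {n} → Graph n → ℕ → Set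
StrongImmersionOfComplete {n} G k =
  Σ (Fin k → Fin n) λ ι →
  Σ (Fin k → Fin k → List (Fin n)) λ P →
    Injective _≡_ _≡_ ι
    × (∀ (u v : Fin k) → toℕ u < toℕ v → IsPath G (ι u) (ι v) (P u v))
    × (∀ (u v u' v' : Fin k) → toℕ u < toℕ v → toℕ u' < toℕ v' →
         ¬ (u ≡ u' × v ≡ v') → EdgeDisjoint (P u v) (P u' v'))
    × (∀ (u v w : Fin k) → toℕ u < toℕ v →
         ¬ Internal (ι u) (ι v) (P u v) (ι w))

{-# OPTIONS --safe #-}
module Submission where

-- Let H be the complement of G. Lay the vertices out on a circle of length N = 3d - 1 along the
-- homomorphism, so that H-adjacent vertices are at distance at least d. Let W be a heaviest arc of
-- length d (a clique of G), followed by the arcs Z and O of lengths d and d - 1. As no arc of length d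
-- is heavier than W, there are injections f : Z → W and g : O → W such that f z precedes z by at least
-- d, and g x lies less than 2d before x. All missing edges between branch vertices in Z ∪ O run from
-- some z to some x, and the paths z, g x, f z, x realise them: f z comes before g x in W, so no edge
-- is used twice. Hence W or Z ∪ O is the branch set of a strong immersion with at least half of the
-- vertices. This suffices unless χ(G) exceeds half of the number of vertices (rounded up); then, by
-- Gallai's lemma on maximum matchings of H, either some vertex can be deleted without lowering χ, or
-- H is disconnected and immersions on the two sides can be joined.

open import Defs
open import Data.Nat
  using (ℕ; zero; suc; _+_; _*_; _∸_; _≤_; _<_; _≤?_; _<?_; z≤n; s≤s; s≤s⁻¹; NonZero; >-nonZero)
open import Data.Nat.DivMod
open import Data.Nat.Properties hiding (_≟_; suc-injective)
open import Data.Fin using (Fin; zero; suc; toℕ; inject≤)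
open import Data.Fin.Properties using (_≟_; any?; all?; suc-injective; inject≤-injective)
open import Data.Empty using (⊥; ⊥-elim)
open import Data.List using (List; []; _∷_; _++_; length; filter; lookup; upTo; allFin)
open import Data.List.Properties using (length-++; filter-notAll; filter-accept; filter-reject)
open import Data.List.Membership.Propositional using (_∈_; _∉_; lose)
open import Data.List.Membership.Propositional.Properties
  using (∈-filter⁺; ∈-filter⁻; ∈-++⁺ˡ; ∈-++⁺ʳ; ∈-++⁻; ∈-∃++; ∈-lookup; ∈-allFin; ∈-upTo⁺)
open import Data.List.Relation.Binary.Permutation.Propositional using (_↭_; ↭-sym; ↭⇒↭ₛ)
open import Data.List.Relation.Binary.Permutation.Propositional.Properties
  using (shift; ↭-length; filter-↭; ∈-resp-↭)
import Data.List.Relation.Binary.Permutation.Setoid.Properties as SetoidPermutation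
open import Data.List.Relation.Unary.All using ([]; _∷_)
import Data.List.Relation.Unary.All as All
open import Data.List.Relation.Unary.AllPairs using ([]; _∷_)
import Data.List.Relation.Unary.AllPairs as AllPairs
open import Data.List.Relation.Unary.Any using (here; there)
import Data.List.Relation.Unary.Any as Any
open import Data.List.Relation.Unary.Unique.Propositional using (Unique)
import Data.List.Relation.Unary.Unique.Propositional.Properties as Unique
open import Data.Product using (∃; ∃-syntax; _×_; _,_; proj₁; proj₂)
open import Data.Sum using (_⊎_; inj₁; inj₂)
open import Data.Unit using (tt)
open import Function using (_∘_)
open import Relation.Binary using (DecidableEquality)
open import Relation.Binary.PropositionalEquality
  using (_≡_; _≢_; refl; trans; cong; subst; subst₂; setoid; module ≡-Reasoning)
  renaming (sym to ≡-sym)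
open import Relation.Nullary using (¬_; Dec; yes; no)
open import Relation.Nullary.Decidable using (¬?; _×-dec_; decidable-stable)
open import Relation.Unary using (Decidable)

-- Covers by colour classes and Gallai's lemma

infixl 6 _─_
_─_ : {V : Set} → (V → Set) → V → V → Set
(A ─ a) x = A x × x ≢ a

infixl 6 _─?_
_─?_ : ∀ {n} {A : Fin n → Set} → Decidable A → ∀ a → Decidable (A ─ a)
(A? ─? a) x = A? x ×-dec ¬? (x ≟ a)

module Covers {n : ℕ} (G : Graph n) where

  -- The colour classes have at most two vertices and may contain vertices outside A.
  Cover : (Fin n → Set) → ℕ → Set
  Cover A zero    = ∀ x → ¬ A x
  Cover A (suc s) = ∃ λ a → ∃ λ b → ¬ Adj G a b × Cover (A ─ a ─ b) s

  Cover-mono : ∀ {A B} s → (∀ {x} → A x → B x) → Cover B s → Cover A s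
  Cover-mono zero    A⊆B c x = c x ∘ A⊆B
  Cover-mono (suc s) A⊆B (a , b , ab , c) =
    a , b , ab , Cover-mono s (λ ((Ax , x≢a) , x≢b) → (A⊆B Ax , x≢a) , x≢b) c

  Cover-pad : ∀ {A} {s t} → Fin n → s ≤ t → Cover A s → Cover A t
  Cover-pad {t = zero}  v z≤n c = c
  Cover-pad {t = suc t} v z≤n c =
    v , v , irrefl G , Cover-pad v z≤n (λ x ((Ax , _) , _) → c x Ax)
  Cover-pad v (s≤s s≤t) (a , b , ab , c) = a , b , ab , Cover-pad v s≤t c

  Cover-list : ∀ xs → Cover (_∈ xs) (length xs)
  Cover-list []       x ()
  Cover-list (x ∷ xs) = x , x , irrefl G , Cover-mono (length xs) tail (Cover-list xs)
    where
    tail : ∀ {y} → ((_∈ x ∷ xs) ─ x ─ x) y → y ∈ xs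
    tail ((here y≡x , y≢x) , _) = ⊥-elim (y≢x y≡x)
    tail ((there y∈ , _) , _)   = y∈

  Cover-⊎ : ∀ {A B C} s t → (∀ {x} → C x → A x ⊎ B x) → Cover A s → Cover B t → Cover C (s + t)
  Cover-⊎ {A} {B} {C} zero t C⊆ c c′ = Cover-mono t inB c′
    where
    inB : ∀ {x} → C x → B x
    inB Cx with C⊆ Cx
    ... | inj₁ Ax = ⊥-elim (c _ Ax)
    ... | inj₂ Bx = Bx
  Cover-⊎ {A} {B} {C} (suc s) t C⊆ (a , b , ab , c) c′ = a , b , ab , Cover-⊎ s t split c c′
    where
    split : ∀ {x} → (C ─ a ─ b) x → (A ─ a ─ b) x ⊎ B x
    split ((Cx , x≢a) , x≢b) with C⊆ Cx
    ... | inj₁ Ax = inj₁ ((Ax , x≢a) , x≢b)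
    ... | inj₂ Bx = inj₂ Bx

  Cover? : ∀ {A} → Decidable A → ∀ s → Dec (Cover A s)
  Cover? A? zero    = all? (¬? ∘ A?)
  Cover? A? (suc s) = any? λ a → any? λ b → ¬? (adj? G a b) ×-dec Cover? (A? ─? a ─? b) s

  -- The order of the classes does not matter, so the class of `w` can come first; its other member
  -- may be `w` itself or a vertex outside `A`.
  Cover-pull : ∀ {A w} s → A w → Cover A (suc s) → ∃ λ y → ¬ Adj G w y × Cover (A ─ w ─ y) s
  Cover-pull {A} {w} s Aw (a , b , ab , c) with w ≟ a | w ≟ b
  ... | yes refl | _        = b , ab , c
  ... | no _     | yes refl =
    a , ab ∘ Graph.sym G , Cover-mono s (λ ((Ax , x≢b) , x≢a) → (Ax , x≢a) , x≢b) c
  Cover-pull zero Aw (a , b , ab , c) | no w≢a | no w≢b = ⊥-elim (c _ ((Aw , w≢a) , w≢b))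
  Cover-pull (suc s) Aw (a , b , ab , c) | no w≢a | no w≢b
    with Cover-pull s ((Aw , w≢a) , w≢b) c
  ... | y , wy , c′ = y , wy , a , b , ab , Cover-mono s
    (λ ((((Ax , x≢w) , x≢y) , x≢a) , x≢b) → (((Ax , x≢a) , x≢b) , x≢w) , x≢y) c′

  -- Follows the alternating path of the two covers that starts at w: it cannot end in both u and v.
  Cover-exchange : ∀ s {A u v w} → Decidable A → A w → w ≢ u → w ≢ v → u ≢ v →
    Cover (A ─ u ─ v) s → Cover (A ─ w) (suc s) →
    Cover (A ─ w ─ u) s ⊎ Cover (A ─ w ─ v) s ⊎ Cover A (suc s)
  Cover-exchange zero A? Aw w≢u w≢v u≢v M N = ⊥-elim (M _ ((Aw , w≢u) , w≢v))
  Cover-exchange (suc s) {A} {u} {v} {w} A? Aw w≢u w≢v u≢v M N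
    with Cover-pull s ((Aw , w≢u) , w≢v) M
  ... | y , wy , M′ with A? y ×-dec ¬? (y ≟ w) ×-dec ¬? (y ≟ u) ×-dec ¬? (y ≟ v)
  -- The path ends at once: `M` gives `w` no partner that has to be covered, so its class is free
  -- for `v`.
  ... | no y-stale = inj₁ (v , v , irrefl G , Cover-mono s
    (λ { ((((Ax , x≢w) , x≢u) , x≢v) , _) →
      (((Ax , x≢u) , x≢v) , x≢w) , λ { refl → y-stale (Ax , x≢w , x≢u , x≢v) } }) M′)
  ... | yes (Ay , y≢w , y≢u , y≢v) with Cover-pull (suc s) (Ay , y≢w) N
  ... | z , yz , N′ with z ≟ u | z ≟ v
  -- The path reaches `u`: flipping it puts `u` into a class with `y`, and `v` stays uncovered.
  ... | yes refl | _ = inj₂ (inj₁ (y , z , yz , Cover-mono s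
    (λ ((((Ax , x≢w) , x≢v) , x≢y) , x≢u) → (((Ax , x≢u) , x≢v) , x≢w) , x≢y) M′))
  ... | no _ | yes refl = inj₁ (y , z , yz , Cover-mono s
    (λ ((((Ax , x≢w) , x≢u) , x≢y) , x≢v) → (((Ax , x≢u) , x≢v) , x≢w) , x≢y) M′)
  ... | no z≢u | no z≢v with A? z ×-dec ¬? (z ≟ w) ×-dec ¬? (z ≟ y)
  -- `N` leaves `y` single, so once `w` joins the class of `y`, all of `A` is covered.
  ... | no z-stale = inj₂ (inj₂ (w , y , wy , Cover-mono (suc s)
    (λ { ((Ax , x≢w) , x≢y) → ((Ax , x≢w) , x≢y) , λ { refl → z-stale (Ax , x≢w , x≢y) } }) N′))
  ... | yes (Az , z≢w , z≢y)
    with Cover-exchange s (A? ─? w ─? y) ((Az , z≢w) , z≢y) z≢u z≢v u≢v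
           (Cover-mono s (λ ((((Ax , x≢w) , x≢y) , x≢u) , x≢v) → (((Ax , x≢u) , x≢v) , x≢w) , x≢y) M′)
           N′
  ... | inj₁ c = inj₁ (y , z , yz , Cover-mono s
    (λ ((((Ax , x≢w) , x≢u) , x≢y) , x≢z) → (((Ax , x≢w) , x≢y) , x≢z) , x≢u) c)
  ... | inj₂ (inj₁ c) = inj₂ (inj₁ (y , z , yz , Cover-mono s
    (λ ((((Ax , x≢w) , x≢v) , x≢y) , x≢z) → (((Ax , x≢w) , x≢y) , x≢z) , x≢v) c))
  ... | inj₂ (inj₂ c) = inj₂ (inj₂ (w , y , wy , c))

  colour : ∀ {A} s → Cover A s → ∀ x → A x → Fin s
  colour zero    c x Ax = ⊥-elim (c x Ax)
  colour (suc s) (a , b , _ , c) x Ax with x ≟ a | x ≟ b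
  ... | yes _  | _      = zero
  ... | no _   | yes _  = zero
  ... | no x≢a | no x≢b = suc (colour s c x ((Ax , x≢a) , x≢b))

  colour-proper : ∀ {A} s (c : Cover A s) {x y} (Ax : A x) (Ay : A y) →
    Adj G x y → colour s c x Ax ≢ colour s c y Ay
  colour-proper zero c Ax Ay xy = ⊥-elim (c _ Ax)
  colour-proper (suc s) (a , b , ab , c) {x} {y} Ax Ay xy eq
    with x ≟ a | x ≟ b | y ≟ a | y ≟ b
  ... | yes refl | _        | yes refl | _        = irrefl G xy
  ... | yes refl | _        | no _     | yes refl = ab xy
  ... | no _     | yes refl | yes refl | _        = ab (Graph.sym G xy)
  ... | no _     | yes refl | no _     | yes refl = irrefl G xy
  ... | no _     | no _     | no _     | no _     = colour-proper s c _ _ xy (suc-injective eq)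
  ... | yes _    | _        | no _     | no _     with () ← eq
  ... | no _     | yes _    | no _     | no _     with () ← eq
  ... | no _     | no _     | yes _    | _        with () ← eq
  ... | no _     | no _     | no _     | yes _    with () ← eq

-- Schemes of branch vertices with partners

length-filter-< : ∀ {V : Set} {P : V → Set} (P? : Decidable P) {x xs} → x ∈ xs → ¬ P x →
  length (filter P? xs) < length xs
length-filter-< P? x∈xs ¬Px = filter-notAll P? _ (lose x∈xs ¬Px)

module Schemes {n : ℕ} (G : Graph n) where
  open Covers G

  V = Fin n

  H : V → V → Set
  H = ComplAdj G

  H? : ∀ u v → Dec (H u v)
  H? u v = ¬? (u ≟ v) ×-dec ¬? (adj? G u v)

  H-sym : ∀ {u v} → H u v → H v u
  H-sym (u≢v , ¬uv) = u≢v ∘ ≡-sym , ¬uv ∘ Graph.sym G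

  ¬H⇒Adj : ∀ {u v} → u ≢ v → ¬ H u v → Adj G u v
  ¬H⇒Adj u≢v ¬H = decidable-stable (adj? G _ _) (λ ¬uv → ¬H (u≢v , ¬uv))

  infix 4 _∈?_
  _∈?_ : ∀ (v : V) xs → Dec (v ∈ xs)
  v ∈? xs = Any.any? (v ≟_) xs

  -- Branch vertices u, v that are not adjacent get joined by the path u, π v, π u, v;
  -- π-inj says that the middle edges of these paths are distinct, and the outer edges follow.
  record Scheme (X B : List V) (π : V → V) : Set where
    field
      unique : Unique B
      B⊆X    : ∀ {u} → u ∈ B → u ∈ X
      π∈X    : ∀ {u v} → u ∈ B → v ∈ B → H u v → π u ∈ X
      π∉B    : ∀ {u v} → u ∈ B → v ∈ B → H u v → π u ∉ B
      outer  : ∀ {u v} → u ∈ B → v ∈ B → H u v → Adj G u (π v)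
      middle : ∀ {u v} → u ∈ B → v ∈ B → H u v → Adj G (π u) (π v)
      π-inj  : ∀ {u v x y} → u ∈ B → v ∈ B → x ∈ B → y ∈ B → H u v → H x y →
               π u ≡ π x → π v ≡ π y → u ≡ x
  open Scheme public

  -- All conditions on the partner map speak of `H`-adjacent branch vertices, so they are vacuous in
  -- a clique of `G`; the identity is a placeholder.
  clique-scheme : ∀ {X B} → Unique B → (∀ {u} → u ∈ B → u ∈ X) →
    (∀ {u v} → u ∈ B → v ∈ B → ¬ H u v) → Scheme X B (λ v → v)
  clique-scheme uB B⊆X ¬H = record
    { unique = uB ; B⊆X = B⊆X
    ; π∈X    = λ u v h → ⊥-elim (¬H u v h)
    ; π∉B    = λ u v h → ⊥-elim (¬H u v h)
    ; outer  = λ u v h → ⊥-elim (¬H u v h)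
    ; middle = λ u v h → ⊥-elim (¬H u v h)
    ; π-inj  = λ u v _ _ h → ⊥-elim (¬H u v h)
    }

  Scheme-mono : ∀ {X Y B π} → (∀ {u} → u ∈ X → u ∈ Y) → Scheme X B π → Scheme Y B π
  Scheme-mono X⊆Y S = record
    { unique = unique S ; B⊆X = X⊆Y ∘ B⊆X S
    ; π∈X    = λ u v h → X⊆Y (π∈X S u v h)
    ; π∉B    = π∉B S ; outer = outer S ; middle = middle S ; π-inj = π-inj S
    }

  -- An `H`-edge between branch vertices stays on one side, and so do the partners of its ends. The
  -- partner maps can therefore be glued along `X`.
  Scheme-join : ∀ {X Y B C π ρ} → (∀ {u v} → u ∈ X → v ∈ Y → ¬ H u v) →
    (∀ {u} → u ∈ X → u ∉ Y) → Scheme X B π → Scheme Y C ρ →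
    ∃ λ σ → Scheme (X ++ Y) (B ++ C) σ
  Scheme-join {X} {Y} {B} {C} {π} {ρ} ¬H disjoint S T = σ , record
    { unique = Unique.++⁺ (unique S) (unique T) (λ (u∈B , u∈C) → disjoint (B⊆X S u∈B) (B⊆X T u∈C))
    ; B⊆X    = B++C⊆X++Y
    ; π∈X    = λ u v h → σ∈ (side u v h)
    ; π∉B    = λ u v h → σ∉ (side u v h)
    ; outer  = λ u v h → σ-outer (side u v h)
    ; middle = λ u v h → σ-middle (side u v h)
    ; π-inj  = λ u v x y h k → σ-inj (side u v h) (side x y k)
    }
    where
    σ : V → V
    σ v with v ∈? X
    ... | yes _ = π v
    ... | no _  = ρ v

    σ-X : ∀ {v} → v ∈ X → σ v ≡ π v
    σ-X {v} v∈X with v ∈? X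
    ... | yes _  = refl
    ... | no v∉X = ⊥-elim (v∉X v∈X)

    σ-Y : ∀ {v} → v ∈ Y → σ v ≡ ρ v
    σ-Y {v} v∈Y with v ∈? X
    ... | yes v∈X = ⊥-elim (disjoint v∈X v∈Y)
    ... | no _    = refl

    B++C⊆X++Y : ∀ {u} → u ∈ B ++ C → u ∈ X ++ Y
    B++C⊆X++Y u∈ with ∈-++⁻ B u∈
    ... | inj₁ u∈B = ∈-++⁺ˡ (B⊆X S u∈B)
    ... | inj₂ u∈C = ∈-++⁺ʳ X (B⊆X T u∈C)

    data Side (u v : V) : Set where
      left  : u ∈ B → v ∈ B → H u v → σ u ≡ π u → σ v ≡ π v → Side u v
      right : u ∈ C → v ∈ C → H u v → σ u ≡ ρ u → σ v ≡ ρ v → Side u v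

    side : ∀ {u v} → u ∈ B ++ C → v ∈ B ++ C → H u v → Side u v
    side u∈ v∈ h with ∈-++⁻ B u∈ | ∈-++⁻ B v∈
    ... | inj₁ u∈B | inj₁ v∈B = left u∈B v∈B h (σ-X (B⊆X S u∈B)) (σ-X (B⊆X S v∈B))
    ... | inj₁ u∈B | inj₂ v∈C = ⊥-elim (¬H (B⊆X S u∈B) (B⊆X T v∈C) h)
    ... | inj₂ u∈C | inj₁ v∈B = ⊥-elim (¬H (B⊆X S v∈B) (B⊆X T u∈C) (H-sym h))
    ... | inj₂ u∈C | inj₂ v∈C = right u∈C v∈C h (σ-Y (B⊆X T u∈C)) (σ-Y (B⊆X T v∈C))

    σ∈ : ∀ {u v} → Side u v → σ u ∈ X ++ Y
    σ∈ (left u v h σu _)  = ∈-++⁺ˡ (subst (_∈ X) (≡-sym σu) (π∈X S u v h))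
    σ∈ (right u v h σu _) = ∈-++⁺ʳ X (subst (_∈ Y) (≡-sym σu) (π∈X T u v h))

    σ∉ : ∀ {u v} → Side u v → σ u ∉ B ++ C
    σ∉ (left u v h σu _) rewrite σu = λ πu∈ → case-B πu∈
      where
      case-B : _ → ⊥
      case-B πu∈ with ∈-++⁻ B πu∈
      ... | inj₁ πu∈B = π∉B S u v h πu∈B
      ... | inj₂ πu∈C = disjoint (π∈X S u v h) (B⊆X T πu∈C)
    σ∉ (right u v h σu _) rewrite σu = λ ρu∈ → case-C ρu∈
      where
      case-C : _ → ⊥
      case-C ρu∈ with ∈-++⁻ B ρu∈
      ... | inj₁ ρu∈B = disjoint (B⊆X S ρu∈B) (π∈X T u v h)
      ... | inj₂ ρu∈C = π∉B T u v h ρu∈C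

    σ-outer : ∀ {u v} → Side u v → Adj G u (σ v)
    σ-outer (left u v h _ σv)  = subst (Adj G _) (≡-sym σv) (outer S u v h)
    σ-outer (right u v h _ σv) = subst (Adj G _) (≡-sym σv) (outer T u v h)

    σ-middle : ∀ {u v} → Side u v → Adj G (σ u) (σ v)
    σ-middle (left u v h σu σv)  = subst₂ (Adj G) (≡-sym σu) (≡-sym σv) (middle S u v h)
    σ-middle (right u v h σu σv) = subst₂ (Adj G) (≡-sym σu) (≡-sym σv) (middle T u v h)

    σ-inj : ∀ {u v x y} → Side u v → Side x y → σ u ≡ σ x → σ v ≡ σ y → u ≡ x
    σ-inj (left u v h σu σv) (left x y k σx σy) p q =
      π-inj S u v x y h k (trans (≡-sym σu) (trans p σx)) (trans (≡-sym σv) (trans q σy))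
    σ-inj (right u v h σu σv) (right x y k σx σy) p q =
      π-inj T u v x y h k (trans (≡-sym σu) (trans p σx)) (trans (≡-sym σv) (trans q σy))
    σ-inj (left u v h σu _) (right x y k σx _) p _ = ⊥-elim (disjoint (π∈X S u v h)
      (subst (_∈ Y) (≡-sym (trans (≡-sym σu) (trans p σx))) (π∈X T x y k)))
    σ-inj (right u v h σu _) (left x y k σx _) p _ = ⊥-elim (disjoint (π∈X S x y k)
      (subst (_∈ Y) (trans (≡-sym σu) (trans p σx)) (π∈X T u v h)))

  -- Covers of lists of vertices, and the reduction to schemes on half of the vertices.

  infixl 6 _∖_
  _∖_ : List V → V → List V
  X ∖ a = filter (λ y → ¬? (y ≟ a)) X

  ∈-∖⁺ : ∀ {X a} {x : V} → ((_∈ X) ─ a) x → x ∈ X ∖ a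
  ∈-∖⁺ (x∈X , x≢a) = ∈-filter⁺ _ x∈X x≢a

  ∈-∖⁻ : ∀ X {a} {x : V} → x ∈ X ∖ a → ((_∈ X) ─ a) x
  ∈-∖⁻ X = ∈-filter⁻ _ {xs = X}

  length-∖ : ∀ {X a} → a ∈ X → length (X ∖ a) < length X
  length-∖ a∈X = length-filter-< _ a∈X (λ a≢a → a≢a refl)

  Covered : List V → ℕ → Set
  Covered X = Cover (_∈ X)

  Covered? : ∀ X s → Dec (Covered X s)
  Covered? X = Cover? (_∈? X)

  Covered-∖⁻ : ∀ {X a s} → Covered (X ∖ a) s → Cover ((_∈ X) ─ a) s
  Covered-∖⁻ {s = s} = Cover-mono s ∈-∖⁺

  Cover-∖∖⁻ : ∀ {X a b s} → Covered (X ∖ a ∖ b) s → Cover ((_∈ X) ─ a ─ b) s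
  Cover-∖∖⁻ {s = s} = Cover-mono s λ (p , q) → ∈-∖⁺ (∈-∖⁺ p , q)

  Cover-∖∖ : ∀ {X a b s} → Cover ((_∈ X) ─ a ─ b) s → Covered (X ∖ a ∖ b) s
  Cover-∖∖ {X} {a} {s = s} = Cover-mono s λ p → let (q , r) = ∈-∖⁻ (X ∖ a) p in ∈-∖⁻ X q , r

  -- If no class of the cover could be shrunk to a single vertex, then all its classes are pairs.
  tight-length : ∀ s {Y} → Covered Y (suc s) → ¬ Covered Y s →
    (∀ {v} → v ∈ Y → ¬ Cover ((_∈ Y) ─ v) s) → suc s + suc s ≤ length Y
  tight-length s {Y} (a , b , ab , c) ¬Y ¬Y─v with a ∈? Y | b ∈? Y | a ≟ b
  ... | no a∉ | no b∉ | _ = ⊥-elim (¬Y (Cover-mono s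
    (λ x∈ → (x∈ , λ { refl → a∉ x∈ }) , λ { refl → b∉ x∈ }) c))
  ... | yes a∈ | no b∉ | _ = ⊥-elim (¬Y─v a∈ (Cover-mono s
    (λ (x∈ , x≢a) → (x∈ , x≢a) , λ { refl → b∉ x∈ }) c))
  ... | no a∉ | yes b∈ | _ = ⊥-elim (¬Y─v b∈ (Cover-mono s
    (λ (x∈ , x≢b) → (x∈ , λ { refl → a∉ x∈ }) , x≢b) c))
  ... | yes a∈ | yes b∈ | yes refl = ⊥-elim (¬Y─v a∈ (Cover-mono s
    (λ (x∈ , x≢a) → (x∈ , x≢a) , x≢a) c))
  ... | yes a∈ | yes b∈ | no a≢b =
    ≤-trans (≤-trans (≤-reflexive (cong suc (+-suc s s))) (s≤s (s≤s (rest s c ¬Y─v))))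
      (≤-trans (s≤s (length-∖ (∈-∖⁺ (b∈ , a≢b ∘ ≡-sym)))) (length-∖ a∈))
    where
    rest : ∀ t → Cover ((_∈ Y) ─ a ─ b) t → (∀ {v} → v ∈ Y → ¬ Cover ((_∈ Y) ─ v) t) →
      t + t ≤ length (Y ∖ a ∖ b)
    rest zero    _ _ = z≤n
    rest (suc t) d ¬d = tight-length t (Cover-∖∖ d)
      -- A class with `b` alone would complete this to a cover of `Y` without `a`.
      (λ d′ → ¬d a∈ (Cover-pad-b d′))
      (λ v∈ d′ → ¬d (proj₁ (proj₁ (unfold v∈))) (a , b , ab , Cover-mono t
        (λ (((x∈ , x≢v) , x≢a) , x≢b) → ∈-∖⁺ (∈-∖⁺ (x∈ , x≢a) , x≢b) , x≢v) d′))
      where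
      unfold : ∀ {v} → v ∈ Y ∖ a ∖ b → ((_∈ Y) ─ a ─ b) v
      unfold v∈ = let (p , q) = ∈-∖⁻ (Y ∖ a) v∈ in ∈-∖⁻ Y p , q
      Cover-pad-b : Covered (Y ∖ a ∖ b) t → Cover ((_∈ Y) ─ a) (suc t)
      Cover-pad-b d′ = b , b , irrefl G , Cover-mono t (λ (p , x≢b) → ∈-∖⁺ (∈-∖⁺ (proj₁ p) , x≢b)) d′

  -- `size` need only bound the covering number from above: the cover limits the number of colours,
  -- and the scheme has at least as many branch vertices.
  record Result (X : List V) : Set where
    constructor result
    field
      {size}   : ℕ
      cover    : Covered X size
      {branch} : List V
      {π}      : V → V
      scheme   : Scheme X branch π
      size≤    : size ≤ length branch

  least : ∀ X t → Covered X t → ¬ Covered X 0 → ∃ λ s → Covered X (suc s) × ¬ Covered X s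
  least X zero    c ¬c = ⊥-elim (¬c c)
  least X (suc t) c ¬c with Covered? X t
  ... | yes c′ = least X t c′ ¬c
  ... | no ¬c′ = t , c , ¬c′

  HalfScheme : List V → Set
  HalfScheme X = ∃ λ B → ∃ λ π → Scheme X B π × length X ≤ length B + length B

  double-< : ∀ {s b} → s + s < b + b → s < b
  double-< {s} {b} lt with suc s ≤? b
  ... | yes s<b = s<b
  ... | no s≮b  = ⊥-elim (<⇒≱ lt (+-mono-≤ (≮⇒≥ s≮b) (≮⇒≥ s≮b)))

  -- Induction following Gallai's lemma: if no vertex can be dropped without lowering the covering
  -- number, then either X has at least 2s - 1 vertices or the complement of G[X] is disconnected.
  module Reduce (half : ∀ X → Unique X → HalfScheme X) where

    reduce : ∀ m X → length X < m → Unique X → Result X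
    reduce zero    X () _
    reduce (suc m) X (s≤s |X|≤m) uX with Covered? X 0
    ... | yes c = result c (clique-scheme {B = []} AllPairs.[] (λ ()) (λ ())) z≤n
    ... | no ¬c with least X (length X) (Cover-list X) ¬c
    ... | s , c , ¬c′ with any? (λ v → v ∈? X ×-dec ¬? (Covered? (X ∖ v) s))
    ... | yes (v , v∈ , ¬cv) = drop (reduce m (X ∖ v) (<-≤-trans (length-∖ v∈) |X|≤m)
                                       (Unique.filter⁺ _ uX))
      where
      drop : Result (X ∖ v) → Result X
      -- With more than `s` classes in `cv`, the scheme is large enough for `c`; otherwise padding
      -- `cv` contradicts the choice of `v`.
      drop (result {size} cv S size≤) with suc s ≤? size
      ... | yes s<size = result c (Scheme-mono (proj₁ ∘ ∈-∖⁻ X) S) (≤-trans s<size size≤)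
      ... | no s≮size  = ⊥-elim (¬cv (Cover-pad v (≮⇒≥ s≮size) cv))
    ... | no allcrit = critical s c ¬c′ (λ {v} v∈ → decidable-stable (Covered? (X ∖ v) s)
                         (λ ¬cv → allcrit (v , v∈ , ¬cv)))
      where
      -- More than `2s` vertices suffice, because half of them, rounded up, is at least `s + 1`.
      large : ∀ s → Covered X (suc s) → s + s < length X → Result X
      large s c s+s<|X| with half X uX
      ... | B , π , S , |X|≤ = result c S (double-< (<-≤-trans s+s<|X| |X|≤))

      critical : ∀ s → Covered X (suc s) → ¬ Covered X s →
        (∀ {v} → v ∈ X → Covered (X ∖ v) s) → Result X
      critical s c ¬c crit with any? (_∈? X)
      ... | no empty = ⊥-elim (¬c (Cover-pad (proj₁ c) z≤n (λ x x∈ → empty (x , x∈))))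
      critical zero c ¬c crit | yes (x₀ , x₀∈) = large 0 c (≤-trans (s≤s z≤n) (length-∖ x₀∈))
      critical (suc s) c ¬c crit | yes (x₀ , x₀∈)
        with any? (λ v → v ∈? X ∖ x₀ ×-dec Covered? (X ∖ x₀ ∖ v) s)
      -- A cover without `x₀` now consists of `s + 1` pairs of distinct vertices, and `x₀` is one
      -- vertex more.
      ... | no ¬apart = large (suc s) c (≤-<-trans
        (tight-length s (crit x₀∈)
          (λ d → ¬c (x₀ , x₀ , irrefl G , Cover-mono s (λ (p , _) → ∈-∖⁺ p) d))
          (λ {v} v∈ d → ¬apart (v , v∈ , Cover-mono s (∈-∖⁻ (X ∖ x₀)) d)))
        (length-∖ x₀∈))
      ... | yes (v , v∈ , v-apart) = join
        (reduce m C
          (<-≤-trans (length-filter-< (¬? ∘ Apart?) (proj₁ (∈-∖⁻ X v∈)) ¬¬apart) |X|≤m)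
          (Unique.filter⁺ _ uX))
        (reduce m D
          (<-≤-trans (length-filter-< Apart? x₀∈ (λ (x₀∈∖ , _) → proj₂ (∈-∖⁻ X x₀∈∖) refl)) |X|≤m)
          (Unique.filter⁺ _ uX))
        where
        -- Deleting both `x₀` and `v` lowers the covering number by two: some maximum matching of
        -- `H` on `X` misses both.
        Apart : V → Set
        Apart v = v ∈ X ∖ x₀ × Covered (X ∖ x₀ ∖ v) s
        Apart? : Decidable Apart
        Apart? v = v ∈? X ∖ x₀ ×-dec Covered? (X ∖ x₀ ∖ v) s
        C D : List V
        C = filter (¬? ∘ Apart?) X
        D = filter Apart? X
        ¬¬apart : ¬ ¬ Apart v
        ¬¬apart ¬a = ¬a (v∈ , v-apart)

        -- If `a b` were an `H`-edge, the exchange along the alternating path from `a` would make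
        -- `a` apart from `x₀`, or else `X` could be covered with too few classes, where needed by
        -- adding the class of `a` and `b`.
        ¬H-CD : ∀ {a b} → a ∈ C → b ∈ D → ¬ H a b
        ¬H-CD {a} {b} a∈C b∈D (a≢b , ¬ab)
          with ∈-filter⁻ (¬? ∘ Apart?) {xs = X} a∈C | ∈-filter⁻ Apart? {xs = X} b∈D
        ... | a∈X , ¬apart | b∈X , b∈∖ , cb with a ≟ x₀
        ... | yes refl = ¬c (a , b , ¬ab , Cover-∖∖⁻ cb)
        ... | no a≢x₀ with Cover-exchange s (_∈? X) a∈X a≢x₀ a≢b
                             (proj₂ (∈-∖⁻ X b∈∖) ∘ ≡-sym) (Cover-∖∖⁻ cb) (Covered-∖⁻ (crit a∈X))
        ... | inj₁ d = ¬apart (∈-∖⁺ (a∈X , a≢x₀) ,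
                Cover-∖∖ (Cover-mono s (λ ((x∈ , p) , q) → (x∈ , q) , p) d))
        ... | inj₂ (inj₁ d) = ¬c (a , b , ¬ab , d)
        ... | inj₂ (inj₂ d) = ¬c d

        X⊆ : ∀ {x} → x ∈ X → x ∈ C ⊎ x ∈ D
        X⊆ {x} x∈ with Apart? x
        ... | yes a = inj₂ (∈-filter⁺ Apart? x∈ a)
        ... | no ¬a = inj₁ (∈-filter⁺ (¬? ∘ Apart?) x∈ ¬a)

        ⊆X : ∀ {x} → x ∈ C ++ D → x ∈ X
        ⊆X x∈ with ∈-++⁻ C x∈
        ... | inj₁ x∈C = proj₁ (∈-filter⁻ (¬? ∘ Apart?) {xs = X} x∈C)
        ... | inj₂ x∈D = proj₁ (∈-filter⁻ Apart? {xs = X} x∈D)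

        join : Result C → Result D → Result X
        join (result {s₁} c₁ {B₁} S₁ s₁≤) (result {s₂} c₂ {B₂} S₂ s₂≤)
          with Scheme-join ¬H-CD
                 (λ x∈C x∈D → proj₂ (∈-filter⁻ (¬? ∘ Apart?) {xs = X} x∈C)
                                (proj₂ (∈-filter⁻ Apart? {xs = X} x∈D)))
                 S₁ S₂
        ... | σ , S = result (Cover-⊎ s₁ s₂ X⊆ c₁ c₂) (Scheme-mono ⊆X S)
          (≤-trans (+-mono-≤ s₁≤ s₂≤) (≤-reflexive (≡-sym (length-++ B₁))))

-- A scheme on half of the vertices

maximum : ∀ {A : Set} (f : A → ℕ) x xs →
  ∃ λ m → m ∈ x ∷ xs × (∀ {y} → y ∈ x ∷ xs → f y ≤ f m)
maximum f x [] = x , here refl , λ { (here refl) → ≤-refl }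
maximum f x (y ∷ ys) with maximum f y ys
... | m , m∈ , max with ≤-total (f x) (f m)
... | inj₁ fx≤fm = m , there m∈ , λ { (here refl) → fx≤fm ; (there z∈) → max z∈ }
... | inj₂ fm≤fx = x , here refl , λ { (here refl) → ≤-refl ; (there z∈) → ≤-trans (max z∈) fm≤fx }

module _ {V : Set} {P Q : V → Set} (P? : Decidable P) (Q? : Decidable Q) where

  length-filter-mono : ∀ xs → (∀ {x} → x ∈ xs → P x → Q x) →
    length (filter P? xs) ≤ length (filter Q? xs)
  length-filter-mono []       P⊆Q = z≤n
  length-filter-mono (x ∷ xs) P⊆Q with P? x | Q? x | length-filter-mono xs (λ x∈ → P⊆Q (there x∈))
  ... | yes _  | yes _  | ih = s≤s ih
  ... | yes Px | no ¬Qx | ih = ⊥-elim (¬Qx (P⊆Q (here refl) Px))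
  ... | no _   | yes _  | ih = m≤n⇒m≤1+n ih
  ... | no _   | no _   | ih = ih

  filter-filter : ∀ xs → filter P? (filter Q? xs) ≡ filter (λ x → Q? x ×-dec P? x) xs
  filter-filter []       = refl
  filter-filter (x ∷ xs) with Q? x
  ... | no _ = filter-filter xs
  ... | yes _ with P? x
  ...   | yes _ = cong (x ∷_) (filter-filter xs)
  ...   | no _  = filter-filter xs

  -- Both sides count the elements that satisfy `P` or `Q`.
  length-filter-difference : ∀ xs →
    length (filter P? xs) + length (filter (λ x → Q? x ×-dec ¬? (P? x)) xs) ≡
    length (filter Q? xs) + length (filter (λ x → P? x ×-dec ¬? (Q? x)) xs)
  length-filter-difference []       = refl
  length-filter-difference (x ∷ xs) with P? x | Q? x | length-filter-difference xs
  ... | yes _ | yes _ | ih = cong suc ih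
  ... | yes _ | no _  | ih = trans (cong suc ih) (≡-sym (+-suc _ _))
  ... | no _  | yes _ | ih = trans (+-suc _ _) (cong suc ih)
  ... | no _  | no _  | ih = ih

-- Injections obtained from threshold counts.

module _ {V : Set} (key : V → ℕ) where

  # : ℕ → List V → ℕ
  # a xs = length (filter (λ x → key x ≤? a) xs)

  #-mono : ∀ {a b} xs → a ≤ b → # a xs ≤ # b xs
  #-mono xs a≤b = length-filter-mono _ _ xs (λ _ k≤a → ≤-trans k≤a a≤b)

  #-accept : ∀ {a x} xs → key x ≤ a → # a (x ∷ xs) ≡ suc (# a xs)
  #-accept xs k≤a = cong length (filter-accept (λ x → key x ≤? _) k≤a)

  #-reject : ∀ {a x} xs → ¬ key x ≤ a → # a (x ∷ xs) ≡ # a xs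
  #-reject xs k≰a = cong length (filter-reject (λ x → key x ≤? _) k≰a)

module _ {V : Set} (_≟_ : DecidableEquality V) (k l : V → ℕ) where

  -- Hall's condition for the relation `l w ≤ k z`: its neighbourhoods form a chain, so it suffices
  -- to count up to each threshold.
  DominatedBy : List V → List V → Set
  DominatedBy Z W = ∀ a → # k a Z ≤ # l a W

  -- The greedy choice for z is the largest l-key of W that is at most the k-key of z.
  DominatedBy⇒injection : ∀ Z W → Unique W → DominatedBy Z W →
    ∃ λ (f : V → V) → (∀ {z} → z ∈ Z → f z ∈ W × l (f z) ≤ k z) ×
            (∀ {y z} → y ∈ Z → z ∈ Z → f y ≡ f z → y ≡ z)
  DominatedBy⇒injection [] W uW dom = (λ v → v) , (λ ()) , λ ()
  DominatedBy⇒injection (z ∷ Z) W uW dom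
    with filter (λ x → l x ≤? k z) W in eq | ≤-trans (≤-reflexive (≡-sym (#-accept k Z ≤-refl))) (dom (k z))
  -- At the threshold `k z` the element `z` itself is counted, so `W` has a candidate.
  ... | [] | lt = ⊥-elim (n≮0 (≤-trans (s≤s z≤n) lt))
  ... | w₀ ∷ ws | _ with maximum l w₀ ws
  ... | w , w∈L , max with ∈-filter⁻ (λ x → l x ≤? k z) {xs = W} (subst (w ∈_) (≡-sym eq) w∈L)
  ... | w∈W , w≤z with ∈-∃++ w∈W
  ... | xs , ys , refl = f , f-spec , f-inj
    where
    W′ : List V
    W′ = xs ++ ys

    perm : W ↭ w ∷ W′
    perm = shift w xs ys

    uwW′ : Unique (w ∷ W′)
    uwW′ = SetoidPermutation.Unique-resp-↭ (setoid V) (↭⇒↭ₛ perm) uW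

    dom₁ : ∀ a → # k a (z ∷ Z) ≤ # l a (w ∷ W′)
    dom₁ a = ≤-trans (dom a) (≤-reflexive (↭-length (filter-↭ (λ x → l x ≤? a) perm)))

    dom-z : ∀ {a} → k z ≤ a → # k a Z ≤ # l a W′
    dom-z {a} z≤a = s≤s⁻¹ (≤-trans (≤-reflexive (≡-sym (#-accept k Z z≤a)))
      (≤-trans (dom₁ a) (≤-reflexive (#-accept l W′ (≤-trans w≤z z≤a)))))

    below-w : ∀ {a} → l w ≤ a → # l (k z) W′ ≤ # l a W′
    below-w w≤a = length-filter-mono _ _ W′ λ x∈ x≤z →
      ≤-trans (max (subst (_ ∈_) eq (∈-filter⁺ _ (∈-resp-↭ (↭-sym perm) (there x∈)) x≤z))) w≤a

    dom′ : DominatedBy Z W′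
    dom′ a with k z ≤? a | l w ≤? a
    ... | yes z≤a | _       = dom-z z≤a
    -- By the choice of `w`, no key in `W′` lies above `l w` and at most at `k z`, so the count at
    -- `k z` is already reached at `a`.
    ... | no z≰a  | yes w≤a = ≤-trans (#-mono k Z (≰⇒≥ z≰a)) (≤-trans (dom-z ≤-refl) (below-w w≤a))
    ... | no z≰a  | no w≰a  = ≤-trans (≤-reflexive (≡-sym (#-reject k Z z≰a)))
      (≤-trans (dom₁ a) (≤-reflexive (#-reject l W′ w≰a)))

    rec = DominatedBy⇒injection Z W′ (AllPairs.tail uwW′) dom′

    f : V → V
    f v with v ≟ z
    ... | yes _ = w
    ... | no _  = proj₁ rec v

    f-spec : ∀ {v} → v ∈ z ∷ Z → f v ∈ W × l (f v) ≤ k v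
    f-spec {v} v∈ with v ≟ z
    ... | yes refl = w∈W , w≤z
    f-spec (here v≡z) | no v≢z = ⊥-elim (v≢z v≡z)
    f-spec (there v∈) | no _ with proj₁ (proj₂ rec) v∈
    ... | fv∈ , fv≤ = ∈-resp-↭ (↭-sym perm) (there fv∈) , fv≤

    rec≢w : ∀ {v} → v ∈ z ∷ Z → v ≢ z → w ≢ proj₁ rec v
    rec≢w (here v≡z) v≢z _ = v≢z v≡z
    rec≢w (there v∈) _   = All.lookup (AllPairs.head uwW′) (proj₁ (proj₁ (proj₂ rec) v∈))

    f-inj : ∀ {x y} → x ∈ z ∷ Z → y ∈ z ∷ Z → f x ≡ f y → x ≡ y
    f-inj {x} {y} x∈ y∈ fx≡fy with x ≟ z | y ≟ z
    ... | yes x≡z | yes y≡z = trans x≡z (≡-sym y≡z)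
    ... | yes _   | no y≢z  = ⊥-elim (rec≢w y∈ y≢z fx≡fy)
    ... | no x≢z  | yes _   = ⊥-elim (rec≢w x∈ x≢z (≡-sym fx≡fy))
    f-inj (here x≡z) _ _ | no x≢z | no _ = ⊥-elim (x≢z x≡z)
    f-inj (there _) (here y≡z) _ | no _ | no y≢z = ⊥-elim (y≢z y≡z)
    f-inj (there x∈) (there y∈) fx≡fy | no _ | no _ = proj₂ (proj₂ rec) x∈ y∈ fx≡fy

length-filter-complement : ∀ {A : Set} {P : A → Set} (P? : Decidable P) xs →
  length xs ≡ length (filter P? xs) + length (filter (¬? ∘ P?) xs)
length-filter-complement P? []       = refl
length-filter-complement P? (x ∷ xs) with P? x
... | yes _ = cong suc (length-filter-complement P? xs)
... | no _  = trans (cong suc (length-filter-complement P? xs)) (≡-sym (+-suc _ _))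

-- Residues modulo `N`.

module _ {N : ℕ} {{_ : NonZero N}} where

  %-+ : ∀ m k → (m % N + k) % N ≡ (m + k) % N
  %-+ m k = begin
    (m % N + k) % N             ≡⟨ %-distribˡ-+ (m % N) k N ⟩
    (m % N % N + k % N) % N     ≡⟨ cong (λ r → (r + k % N) % N) (m%n%n≡m%n m N) ⟩
    (m % N + k % N) % N         ≡⟨ %-distribˡ-+ m k N ⟨
    (m + k) % N                 ∎
    where open ≡-Reasoning

  %-wrap : ∀ {m} → N ≤ m → m < N + N → m % N + N ≡ m
  %-wrap {m} N≤m m<2N = begin
    m % N + N        ≡⟨ cong (_+ N) (m≤n⇒[n∸m]%m≡n%m N≤m) ⟨
    (m ∸ N) % N + N  ≡⟨ cong (_+ N) (m<n⇒m%n≡m (m<n+o⇒m∸n<o m N m<2N)) ⟩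
    m ∸ N + N        ≡⟨ m∸n+n≡m N≤m ⟩
    m                ∎
    where open ≡-Reasoning

-- Positions on the circle and the heaviest arc.

module CircularOrder {n : ℕ} (G : Graph n) (e N : ℕ) {{_ : NonZero N}}
  (1+N≡3d : suc N ≡ suc e + (suc e + suc e)) (h : Fin n → ℕ)
  (edge : ∀ {u v} → ComplAdj G u v →
    ∃[ i ] (suc e ≤ i × i < suc e + suc e × ∃[ q ] (h u + i ≡ h v + q * N)))
  where
  open Schemes G

  d : ℕ
  d = suc e

  2d≤N : d + d ≤ N
  2d≤N = s≤s⁻¹ (≤-trans (≤-reflexive (+-comm 1 (d + d)))
    (≤-trans (+-monoʳ-≤ (d + d) (s≤s z≤n))
      (≤-reflexive (trans (+-assoc d d d) (≡-sym 1+N≡3d)))))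

  N<3d : N < d + (d + d)
  N<3d = ≤-reflexive 1+N≡3d

  d≤N : d ≤ N
  d≤N = ≤-trans (m≤m+n d d) 2d≤N

  module Cut (c : ℕ) where

    o : V → ℕ
    o x = (h x + c) % N

    o<N : ∀ x → o x < N
    o<N x = m%n<n (h x + c) N

    -- Every turned window is thus the initial window of another cut, which lets a maximal cut bound
    -- all windows.
    shift-o : ∀ x b → (o x + b) % N ≡ (h x + (c + b) % N) % N
    shift-o x b = begin
      (o x + b) % N              ≡⟨ %-+ (h x + c) b ⟩
      (h x + c + b) % N          ≡⟨ cong (_% N) (+-assoc (h x) c b) ⟩
      (h x + (c + b)) % N        ≡⟨ cong (_% N) (+-comm (h x) (c + b)) ⟩
      (c + b + h x) % N          ≡⟨ %-+ (c + b) (h x) ⟨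
      ((c + b) % N + h x) % N    ≡⟨ cong (_% N) (+-comm ((c + b) % N) (h x)) ⟩
      (h x + (c + b) % N) % N    ∎
      where open ≡-Reasoning

    o-edge : ∀ {u v i} q → h u + i ≡ h v + q * N → (o u + i) % N ≡ o v
    o-edge {u} {v} {i} q eq = begin
      (o u + i) % N            ≡⟨ %-+ (h u + c) i ⟩
      (h u + c + i) % N        ≡⟨ cong (_% N) (+-right-comm (h u) c i) ⟩
      (h u + i + c) % N        ≡⟨ cong (λ m → (m + c) % N) eq ⟩
      (h v + q * N + c) % N    ≡⟨ cong (_% N) (+-right-comm (h v) (q * N) c) ⟩
      (h v + c + q * N) % N    ≡⟨ [m+kn]%n≡m%n (h v + c) q N ⟩
      o v                      ∎
      where
      open ≡-Reasoning
      +-right-comm : ∀ a b c → a + b + c ≡ a + c + b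
      +-right-comm a b c = trans (+-assoc a b c) (trans (cong (a +_) (+-comm b c)) (≡-sym (+-assoc a c b)))

    infix 4 _≪_
    _≪_ : V → V → Set
    u ≪ v = o u + d ≤ o v × o v < o u + (d + d)

    -- The range from `d` to `2d - 1` is symmetric under taking `i` to `N - i`, so an edge that
    -- wraps around only exchanges the roles of `u` and `v`.
    H⇒≪ : ∀ {u v} → H u v → u ≪ v ⊎ v ≪ u
    H⇒≪ {u} {v} uv with edge uv
    ... | i , d≤i , i<2d , q , eq with suc (o u + i) ≤? N
    ... | yes lt = inj₁ (subst (o u + d ≤_) ov (+-monoʳ-≤ (o u) d≤i) ,
                         subst (_< o u + (d + d)) ov (+-monoʳ-< (o u) i<2d))
      where
      ov : o u + i ≡ o v
      ov = trans (≡-sym (m<n⇒m%n≡m lt)) (o-edge q eq)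
    ... | no ¬lt = inj₂ (+-cancelʳ-≤ i _ _ lower , +-cancelʳ-< i _ _ upper)
      where
      open ≤-Reasoning
      i≤N : i ≤ N
      i≤N = ≤-trans (<⇒≤ i<2d) 2d≤N
      ov : o v + N ≡ o u + i
      ov = trans (cong (_+ N) (≡-sym (o-edge q eq))) (%-wrap (≮⇒≥ ¬lt) (+-mono-<-≤ (o<N u) i≤N))
      lower : o v + d + i ≤ o u + i
      lower = begin
        o v + d + i    ≡⟨ +-assoc (o v) d i ⟩
        o v + (d + i)  ≤⟨ +-monoʳ-≤ (o v) (s≤s⁻¹ (≤-trans (≤-reflexive (≡-sym (+-suc d i)))
                            (≤-trans (+-monoʳ-≤ d i<2d) (≤-reflexive (≡-sym 1+N≡3d))))) ⟩
        o v + N        ≡⟨ ov ⟩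
        o u + i        ∎
      upper : o u + i < o v + (d + d) + i
      upper = begin-strict
        o u + i              ≡⟨ ov ⟨
        o v + N              <⟨ +-monoʳ-< (o v) N<3d ⟩
        o v + (d + (d + d))  ≡⟨ cong (o v +_) (+-assoc d d d) ⟨
        o v + (d + d + d)    ≡⟨ +-assoc (o v) (d + d) d ⟨
        o v + (d + d) + d    ≤⟨ +-monoʳ-≤ (o v + (d + d)) d≤i ⟩
        o v + (d + d) + i    ∎

    Window? : ∀ b → Decidable (λ x → (o x + b) % N < d)
    Window? b x = (o x + b) % N <? d

    W? : Decidable (λ x → o x < d)
    W? x = o x <? d

    module Maximal (X : List V) (uX : Unique X)
      (window≤ : ∀ b → length (filter (Window? b) X) ≤ length (filter W? X)) where

      Z? : Decidable (λ x → d ≤ o x × o x < d + d)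
      Z? x = (d ≤? o x) ×-dec (o x <? d + d)

      O? : Decidable (λ x → d + d ≤ o x)
      O? x = d + d ≤? o x

      W B Z O : List V
      W = filter W? X
      B = filter (¬? ∘ W?) X
      Z = filter Z? X
      O = filter O? X

      -- Rotating the window by b does not make it heavier: what enters it weighs at most what leaves it.
      dominated : ∀ b {A : V → Set} (A? : Decidable A) (k l : V → ℕ) a →
        (∀ {x} → A x → k x ≤ a → (o x + b) % N < d × ¬ o x < d) →
        (∀ {x} → o x < d → ¬ (o x + b) % N < d → l x ≤ a) →
        # k a (filter A? X) ≤ # l a W
      dominated b A? k l a enter leave = begin
        # k a (filter A? X)
          ≡⟨ cong length (filter-filter _ A? X) ⟩
        length (filter (λ x → A? x ×-dec (k x ≤? a)) X)
          ≤⟨ length-filter-mono _ _ X (λ _ (Ax , kx≤a) → enter Ax kx≤a) ⟩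
        length (filter (λ x → Window? b x ×-dec ¬? (W? x)) X)
          ≤⟨ gain≤loss ⟩
        length (filter (λ x → W? x ×-dec ¬? (Window? b x)) X)
          ≤⟨ length-filter-mono _ _ X (λ _ (w , ¬win) → w , leave w ¬win) ⟩
        length (filter (λ x → W? x ×-dec (l x ≤? a)) X)
          ≡⟨ cong length (filter-filter _ W? X) ⟨
        # l a W
          ∎
        where
        open ≤-Reasoning
        gain≤loss : length (filter (λ x → Window? b x ×-dec ¬? (W? x)) X) ≤
                    length (filter (λ x → W? x ×-dec ¬? (Window? b x)) X)
        gain≤loss = +-cancelˡ-≤ (length W) _ _ (begin
          length W + _                      ≡⟨ length-filter-difference (Window? b) W? X ⟨
          length (filter (Window? b) X) + _ ≤⟨ +-monoˡ-≤ _ (window≤ b) ⟩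
          length W + _                      ∎)

      shift-back : ∀ x {a} → a ≤ N → a ≤ o x → (o x + (N ∸ a)) % N ≡ o x ∸ a
      shift-back x {a} a≤N a≤o = begin
        (o x + (N ∸ a)) % N      ≡⟨ cong (_% N) (+-∸-assoc (o x) a≤N) ⟨
        (o x + N ∸ a) % N        ≡⟨ cong (_% N) (+-∸-comm N a≤o) ⟩
        (o x ∸ a + N) % N        ≡⟨ [m+n]%n≡m%n (o x ∸ a) N ⟩
        (o x ∸ a) % N            ≡⟨ m<n⇒m%n≡m (≤-<-trans (m∸n≤m (o x) a) (o<N x)) ⟩
        o x ∸ a                  ∎
        where open ≡-Reasoning

      -- Turning by `N ∸ b` moves the window to the positions from `b` to `b + d - 1`, so it loses
      -- exactly the part of `W` below `b`.
      Z-dominated-by : ∀ b a → b ≤ d → (∀ {x} → o x < d + d → o x ∸ d ≤ a → o x < b + d) →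
        (∀ {x} → o x < d → o x < b → o x ≤ a) → # (λ x → o x ∸ d) a Z ≤ # o a W
      Z-dominated-by b a b≤d enter leave = dominated (N ∸ b) Z? _ o a
        (λ {x} (d≤o , o<2d) k≤a → subst (_< d) (≡-sym (shift-back x b≤N (≤-trans b≤d d≤o)))
            (m<n+o⇒m∸n<o (o x) b (enter o<2d k≤a)) , ≤⇒≯ d≤o)
        (λ {x} o<d ¬win → leave o<d (≰⇒> λ b≤o → ¬win
            (subst (_< d) (≡-sym (shift-back x b≤N b≤o)) (≤-<-trans (m∸n≤m (o x) b) o<d))))
        where
        b≤N = ≤-trans b≤d d≤N

      Z-dominated : DominatedBy _≟_ (λ x → o x ∸ d) o Z W
      Z-dominated a with suc a ≤? d
      ... | yes a<d = Z-dominated-by (suc a) a a<d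
        (λ {x} _ o∸d≤a → s≤s (≤-trans (m≤n+m∸n (o x) d)
          (≤-trans (+-monoʳ-≤ d o∸d≤a) (≤-reflexive (+-comm d a)))))
        (λ _ o<1+a → s≤s⁻¹ o<1+a)
      -- For these thresholds the window with `b = d`, which is the arc of `Z`, suffices.
      ... | no a≮d = Z-dominated-by d a ≤-refl (λ o<2d _ → o<2d)
        (λ o<d _ → <⇒≤ (<-≤-trans o<d (≮⇒≥ a≮d)))

      -- Turning by `b` moves the window to the last `b` positions of the circle and the first
      -- `d - b`; the keys are distances to the end of the circle and to the end of the arc of `W`.
      O-dominated-by : ∀ b a → b < d → b ≤ a → (∀ {x} → d + d ≤ o x → N ∸ o x ≤ a → N ≤ o x + b) →
        # (λ x → N ∸ o x) a O ≤ # (λ x → d ∸ o x) a W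
      O-dominated-by b a b<d b≤a enter = dominated b O? _ _ a
        (λ {x} 2d≤o k≤a →
          +-cancelʳ-< N _ _ (subst (_< d + N)
            (≡-sym (%-wrap (enter 2d≤o k≤a) (+-mono-< (o<N x) (<-≤-trans b<d d≤N))))
            (<-≤-trans (+-mono-< (o<N x) b<d) (≤-reflexive (+-comm N d)))) ,
          ≤⇒≯ (≤-trans (m≤m+n d d) 2d≤o))
        (λ {x} o<d ¬win → ≤-trans (m≤n+o⇒m∸n≤o d (o x)
          (≮⇒≥ λ o+b<d → ¬win (subst (_< d) (≡-sym (m<n⇒m%n≡m (<-≤-trans o+b<d d≤N))) o+b<d))) b≤a)

      O-dominated : DominatedBy _≟_ (λ x → N ∸ o x) (λ x → d ∸ o x) O W
      O-dominated a with a ≤? e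
      ... | yes a≤e = O-dominated-by a a (s≤s a≤e) ≤-refl
        (λ {x} _ k≤a → ≤-trans (m≤n+m∸n N (o x)) (+-monoʳ-≤ (o x) k≤a))
      -- The arc of `O` has only `e` positions, so turning by `e` takes in all of it.
      ... | no a≰e = O-dominated-by e a ≤-refl (≰⇒≥ a≰e)
        (λ {x} 2d≤o _ → s≤s⁻¹ (≤-trans (≤-reflexive (trans 1+N≡3d (trans (≡-sym (+-assoc d d d)) (+-suc (d + d) e))))
          (s≤s (+-monoˡ-≤ e 2d≤o))))

      uW : Unique W
      uW = Unique.filter⁺ _ uX

      f-data = DominatedBy⇒injection _≟_ _ _ Z W uW Z-dominated
      g-data = DominatedBy⇒injection _≟_ _ _ O W uW O-dominated

      f g π : V → V
      f = proj₁ f-data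
      g = proj₁ g-data
      π x with O? x
      ... | yes _ = g x
      ... | no _  = f x

      π-O : ∀ {x} → d + d ≤ o x → π x ≡ g x
      π-O {x} 2d≤o with O? x
      ... | yes _ = refl
      ... | no ¬p = ⊥-elim (¬p 2d≤o)

      π-Z : ∀ {x} → o x < d + d → π x ≡ f x
      π-Z {x} o<2d with O? x
      ... | yes p = ⊥-elim (<⇒≱ o<2d p)
      ... | no _  = refl

      W⊆X : ∀ {x} → x ∈ W → x ∈ X
      W⊆X = proj₁ ∘ ∈-filter⁻ W? {xs = X}

      o-W : ∀ {x} → x ∈ W → o x < d
      o-W = proj₂ ∘ ∈-filter⁻ W? {xs = X}

      B⇒X : ∀ {x} → x ∈ B → x ∈ X
      B⇒X = proj₁ ∘ ∈-filter⁻ (¬? ∘ W?) {xs = X}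

      o-B : ∀ {x} → x ∈ B → d ≤ o x
      o-B = ≮⇒≥ ∘ proj₂ ∘ ∈-filter⁻ (¬? ∘ W?) {xs = X}

      W∩B : ∀ {x} → x ∈ W → x ∉ B
      W∩B x∈W x∈B = <⇒≱ (o-W x∈W) (o-B x∈B)

      -- An `H`-edge inside `B`, oriented from its earlier end in `Z` to its later end in `O`.
      record Pair (u v : V) : Set where
        field
          u∈Z   : u ∈ Z
          v∈O   : v ∈ O
          πu≡   : π u ≡ f u
          πv≡   : π v ≡ g v
          πu∈W  : π u ∈ W
          πv∈W  : π v ∈ W
          outer-u : Adj G u (π v)
          outer-v : Adj G v (π u)
          π<    : o (π u) < o (π v)
      open Pair

      -- With `p` and `r` the positions of `π u` and `π v`, one has `p + d ≤ o u < r + d`. So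
      -- `p < r`, `u` is less than `d` beyond `π v`, and `v` is at least `2d` beyond `π u`; neither
      -- distance permits an `H`-edge.
      pair : ∀ {u v} → u ∈ B → v ∈ B → u ≪ v → Pair u v
      pair {u} {v} u∈B v∈B (u+d≤v , v<u+2d) = record
        { u∈Z = u∈Z′ ; v∈O = v∈O′ ; πu≡ = πu≡′ ; πv≡ = πv≡′ ; πu∈W = πu∈ ; πv∈W = πv∈
        ; outer-u = ¬H⇒Adj (λ { refl → W∩B πv∈ u∈B }) (λ h → far-u (H⇒≪ h))
        ; outer-v = ¬H⇒Adj (λ { refl → W∩B πu∈ v∈B }) (λ h → far-v (H⇒≪ h))
        ; π< = +-cancelʳ-< d _ _ (≤-<-trans p+d≤u u<r+d)
        }
        where
        2d≤v : d + d ≤ o v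
        2d≤v = ≤-trans (+-monoˡ-≤ d (o-B u∈B)) u+d≤v
        u<2d : o u < d + d
        u<2d = +-cancelʳ-< d _ _ (≤-<-trans u+d≤v (<-trans (o<N v)
          (<-≤-trans N<3d (≤-reflexive (≡-sym (+-assoc d d d))))))
        u∈Z′ : u ∈ Z
        u∈Z′ = ∈-filter⁺ Z? (B⇒X u∈B) (o-B u∈B , u<2d)
        v∈O′ : v ∈ O
        v∈O′ = ∈-filter⁺ O? (B⇒X v∈B) 2d≤v
        πu≡′ = π-Z u<2d
        πv≡′ = π-O 2d≤v
        πu∈ : π u ∈ W
        πu∈ = subst (_∈ W) (≡-sym πu≡′) (proj₁ (proj₁ (proj₂ f-data) u∈Z′))
        πv∈ : π v ∈ W
        πv∈ = subst (_∈ W) (≡-sym πv≡′) (proj₁ (proj₁ (proj₂ g-data) v∈O′))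
        p+d≤u : o (π u) + d ≤ o u
        p+d≤u = ≤-trans (+-monoˡ-≤ d (subst (λ w → o w ≤ o u ∸ d) (≡-sym πu≡′)
          (proj₂ (proj₁ (proj₂ f-data) u∈Z′)))) (≤-reflexive (m∸n+n≡m (o-B u∈B)))
        v+d≤r+N : o v + d ≤ o (π v) + N
        v+d≤r+N = begin
          o v + d                          ≤⟨ +-monoʳ-≤ (o v) (m≤n+m∸n d (o (π v))) ⟩
          o v + (o (π v) + (d ∸ o (π v)))  ≤⟨ +-monoʳ-≤ (o v) (+-monoʳ-≤ (o (π v))
              (subst (λ w → d ∸ o w ≤ N ∸ o v) (≡-sym πv≡′) (proj₂ (proj₁ (proj₂ g-data) v∈O′)))) ⟩
          o v + (o (π v) + (N ∸ o v))      ≡⟨ +-comm (o v) _ ⟩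
          o (π v) + (N ∸ o v) + o v        ≡⟨ +-assoc (o (π v)) _ _ ⟩
          o (π v) + (N ∸ o v + o v)        ≡⟨ cong (o (π v) +_) (m∸n+n≡m (<⇒≤ (o<N v))) ⟩
          o (π v) + N                      ∎
          where open ≤-Reasoning
        u<r+d : o u < o (π v) + d
        u<r+d = +-cancelʳ-< (d + d) _ _ (begin-strict
          o u + (d + d)          ≡⟨ +-assoc (o u) d d ⟨
          o u + d + d            ≤⟨ +-monoˡ-≤ d u+d≤v ⟩
          o v + d                ≤⟨ v+d≤r+N ⟩
          o (π v) + N            <⟨ +-monoʳ-< (o (π v)) N<3d ⟩
          o (π v) + (d + (d + d)) ≡⟨ +-assoc (o (π v)) d (d + d) ⟨
          o (π v) + d + (d + d)  ∎)
          where open ≤-Reasoning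
        far-u : u ≪ π v ⊎ π v ≪ u → ⊥
        far-u (inj₁ (u+d≤r , _)) = <⇒≱ (o-W πv∈) (≤-trans (m≤n+m d (o u)) u+d≤r)
        far-u (inj₂ (r+d≤u , _)) = <⇒≱ u<r+d r+d≤u
        far-v : v ≪ π u ⊎ π u ≪ v → ⊥
        far-v (inj₁ (v+d≤p , _)) = <⇒≱ (o-W πu∈) (≤-trans (m≤n+m d (o v)) v+d≤p)
        far-v (inj₂ (_ , v<p+2d)) = <⇒≱ v<p+2d (≤-trans (≤-reflexive (≡-sym (+-assoc (o (π u)) d d)))
          (≤-trans (+-monoˡ-≤ d p+d≤u) u+d≤v))

      W-clique : ∀ {u v} → u ∈ W → v ∈ W → ¬ H u v
      W-clique {u} {v} u∈W v∈W uv with H⇒≪ uv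
      ... | inj₁ (u+d≤v , _) = <⇒≱ (o-W v∈W) (≤-trans (m≤n+m d (o u)) u+d≤v)
      ... | inj₂ (v+d≤u , _) = <⇒≱ (o-W u∈W) (≤-trans (m≤n+m d (o v)) v+d≤u)

      W-adj : ∀ {u v} → u ∈ W → v ∈ W → o u < o v → Adj G u v
      W-adj u∈W v∈W u<v = ¬H⇒Adj (λ { refl → <-irrefl refl u<v }) (W-clique u∈W v∈W)

      pair⊎ : ∀ {u v} → u ∈ B → v ∈ B → H u v → Pair u v ⊎ Pair v u
      pair⊎ u∈B v∈B uv with H⇒≪ uv
      ... | inj₁ u≪v = inj₁ (pair u∈B v∈B u≪v)
      ... | inj₂ v≪u = inj₂ (pair v∈B u∈B v≪u)

      π∈W : ∀ {u v} → u ∈ B → v ∈ B → H u v → π u ∈ W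
      π∈W u∈B v∈B uv with pair⊎ u∈B v∈B uv
      ... | inj₁ p = πu∈W p
      ... | inj₂ p = πv∈W p

      π-outer : ∀ {u v} → u ∈ B → v ∈ B → H u v → Adj G u (π v)
      π-outer u∈B v∈B uv with pair⊎ u∈B v∈B uv
      ... | inj₁ p = outer-u p
      ... | inj₂ p = outer-v p

      π-middle : ∀ {u v} → u ∈ B → v ∈ B → H u v → Adj G (π u) (π v)
      π-middle u∈B v∈B uv with pair⊎ u∈B v∈B uv
      ... | inj₁ p = W-adj (πu∈W p) (πv∈W p) (π< p)
      ... | inj₂ p = Graph.sym G (W-adj (πu∈W p) (πv∈W p) (π< p))

      π-injective : ∀ {u v x y} → u ∈ B → v ∈ B → x ∈ B → y ∈ B → H u v → H x y →
        π u ≡ π x → π v ≡ π y → u ≡ x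
      π-injective {u} {v} {x} {y} u∈B v∈B x∈B y∈B uv xy πu≡πx πv≡πy
        with pair⊎ u∈B v∈B uv | pair⊎ x∈B y∈B xy
      ... | inj₁ p | inj₁ q = proj₂ (proj₂ f-data) (u∈Z p) (u∈Z q)
        (trans (≡-sym (πu≡ p)) (trans πu≡πx (πu≡ q)))
      ... | inj₂ p | inj₂ q = proj₂ (proj₂ g-data) (v∈O p) (v∈O q)
        (trans (≡-sym (πv≡ p)) (trans πu≡πx (πv≡ q)))
      -- Pairs of opposite orientation would place the same two partners in both orders.
      ... | inj₁ p | inj₂ q = ⊥-elim (<-asym (π< p) (subst₂ (λ a b → o a < o b) (≡-sym πv≡πy) (≡-sym πu≡πx) (π< q)))
      ... | inj₂ p | inj₁ q = ⊥-elim (<-asym (π< p) (subst₂ (λ a b → o a < o b) (≡-sym πu≡πx) (≡-sym πv≡πy) (π< q)))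

      half-scheme : HalfScheme X
      half-scheme with ≤-total (length B) (length W)
      ... | inj₁ |B|≤|W| = W , (λ v → v) , clique-scheme uW W⊆X W-clique ,
        ≤-trans (≤-reflexive (length-filter-complement W? X)) (+-monoʳ-≤ (length W) |B|≤|W|)
      ... | inj₂ |W|≤|B| = B , π , record
        { unique = Unique.filter⁺ _ uX
        ; B⊆X    = B⇒X
        ; π∈X    = λ u v h → W⊆X (π∈W u v h)
        ; π∉B    = λ u v h → W∩B (π∈W u v h)
        ; outer  = π-outer
        ; middle = π-middle
        ; π-inj  = π-injective
        } , ≤-trans (≤-reflexive (length-filter-complement W? X)) (+-monoˡ-≤ (length B) |W|≤|B|)

  half : ∀ X → Unique X → HalfScheme X
  -- The leading 0 gives `maximum` its first entry; `upTo N` contains every cut modulo `N`.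
  half X uX with maximum (λ c → length (filter (Cut.W? c) X)) 0 (upTo N)
  ... | c , _ , max = Maximal.half-scheme X uX λ b →
    ≤-trans (length-filter-mono (Window? b) (Cut.W? ((c + b) % N)) X
               (λ {x} _ → subst (_< d) (shift-o x b)))
      (max (there (∈-upTo⁺ (m%n<n (c + b) N))))
    where open Cut c

-- From schemes to immersions

lookup-injective : ∀ {A : Set} {xs : List A} → Unique xs → ∀ i j → lookup xs i ≡ lookup xs j → i ≡ j
lookup-injective (x∉ ∷ _)  zero    zero    _  = refl
lookup-injective (x∉ ∷ _)  zero    (suc j) eq = ⊥-elim (All.lookup x∉ (∈-lookup j) eq)
lookup-injective (x∉ ∷ _)  (suc i) zero    eq = ⊥-elim (All.lookup x∉ (∈-lookup i) (≡-sym eq))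
lookup-injective (_ ∷ uxs) (suc i) (suc j) eq = cong suc (lookup-injective uxs i j eq)

module Immersion {n : ℕ} (G : Graph n) where
  open Schemes G

  module _ {X B : List V} {π : V → V} (S : Scheme X B π) where

    path : V → V → List V
    path u v with H? u v
    ... | yes _ = u ∷ π v ∷ π u ∷ v ∷ []
    ... | no _  = u ∷ v ∷ []

    isPath : ∀ {u v} → u ∈ B → v ∈ B → u ≢ v → IsPath G u v (path u v)
    isPath {u} {v} u∈B v∈B u≢v with H? u v
    ... | no ¬uv = refl , refl , (¬H⇒Adj u≢v ¬uv , tt) , ((u≢v ∷ []) ∷ [] ∷ [])
    ... | yes uv = refl , refl ,
      (outer S u∈B v∈B uv , Graph.sym G (middle S u∈B v∈B uv) ,
       Graph.sym G (outer S v∈B u∈B vu) , tt) ,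
      ((u≢πv ∷ u≢πu ∷ u≢v ∷ []) ∷ (πv≢πu ∷ πv≢v ∷ []) ∷ (πu≢v ∷ []) ∷ [] ∷ [])
      where
      vu = H-sym uv
      u≢πv : u ≢ π v
      u≢πv eq = π∉B S v∈B u∈B vu (subst (_∈ B) eq u∈B)
      u≢πu : u ≢ π u
      u≢πu eq = π∉B S u∈B v∈B uv (subst (_∈ B) eq u∈B)
      πv≢v : π v ≢ v
      πv≢v eq = π∉B S v∈B u∈B vu (subst (_∈ B) (≡-sym eq) v∈B)
      πu≢v : π u ≢ v
      πu≢v eq = π∉B S u∈B v∈B uv (subst (_∈ B) (≡-sym eq) v∈B)
      πv≢πu : π v ≢ π u
      πv≢πu eq = irrefl G (subst (λ w → Adj G w (π v)) (≡-sym eq) (middle S u∈B v∈B uv))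

    internal : ∀ {u v w} → u ∈ B → v ∈ B → w ∈ B → ¬ Internal u v (path u v) w
    internal {u} {v} u∈B v∈B w∈B (w∈ , w≢u , w≢v) with H? u v | w∈
    ... | no _   | here w≡u                         = w≢u w≡u
    ... | no _   | there (here w≡v)                 = w≢v w≡v
    ... | yes _  | here w≡u                         = w≢u w≡u
    ... | yes uv | there (here refl)                = π∉B S v∈B u∈B (H-sym uv) w∈B
    ... | yes uv | there (there (here refl))        = π∉B S u∈B v∈B uv w∈B
    ... | yes _  | there (there (there (here w≡v))) = w≢v w≡v

    -- Oriented edges of a path up to exchanging its ends: reversal swaps `start` with `finish`, and
    -- the other two kinds turn into themselves with `u` and `v` exchanged.
    data Uses (u v a b : V) : Set where
      direct : a ≡ u → b ≡ v → Uses u v a b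
      start  : H u v → a ≡ u → b ≡ π v → Uses u v a b
      finish : H u v → a ≡ π v → b ≡ u → Uses u v a b
      centre : H u v → a ≡ π u → b ≡ π v → Uses u v a b

    uses : ∀ {u v a b} → UsesEdge (path u v) a b → Uses u v a b ⊎ Uses v u a b
    uses {u} {v} e with H? u v
    uses (inj₁ (here refl))                 | no _   = inj₁ (direct refl refl)
    uses (inj₂ (here refl))                 | no _   = inj₂ (direct refl refl)
    uses (inj₁ (here refl))                 | yes uv = inj₁ (start uv refl refl)
    uses (inj₁ (there (here refl)))         | yes uv = inj₂ (centre (H-sym uv) refl refl)
    uses (inj₁ (there (there (here refl)))) | yes uv = inj₂ (finish (H-sym uv) refl refl)
    uses (inj₂ (here refl))                 | yes uv = inj₁ (finish uv refl refl)
    uses (inj₂ (there (here refl)))         | yes uv = inj₁ (centre uv refl refl)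
    uses (inj₂ (there (there (here refl)))) | yes uv = inj₂ (start (H-sym uv) refl refl)

    uses-determines : ∀ {u v x y a b} → u ∈ B → v ∈ B → x ∈ B → y ∈ B →
      Uses u v a b → Uses x y a b → u ≡ x × v ≡ y
    uses-determines {u} {v} {x} {y} {a} {b} u∈B v∈B x∈B y∈B = go
      where
      B∌π : ∀ {w s t} → w ∈ B → s ∈ B → t ∈ B → H s t → w ≢ π s
      B∌π w∈B s∈B t∈B st w≡πs = π∉B S s∈B t∈B st (subst (_∈ B) w≡πs w∈B)

      go : Uses u v a b → Uses x y a b → u ≡ x × v ≡ y
      go (direct refl refl)    (direct refl refl)    = refl , refl
      go (direct refl refl)    (start xy _ v≡πy)     = ⊥-elim (B∌π v∈B y∈B x∈B (H-sym xy) v≡πy)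
      go (direct refl refl)    (finish xy u≡πy _)    = ⊥-elim (B∌π u∈B y∈B x∈B (H-sym xy) u≡πy)
      go (direct refl refl)    (centre xy u≡πx _)    = ⊥-elim (B∌π u∈B x∈B y∈B xy u≡πx)
      go (start uv _ b≡πv)     (direct _ refl)       = ⊥-elim (B∌π y∈B v∈B u∈B (H-sym uv) b≡πv)
      go (finish uv a≡πv _)    (direct refl _)       = ⊥-elim (B∌π x∈B v∈B u∈B (H-sym uv) a≡πv)
      go (centre uv a≡πu _)    (direct refl _)       = ⊥-elim (B∌π x∈B u∈B v∈B uv a≡πu)
      -- Both edges leave the same branch vertex, so one of the two equations for `π-inj` is `refl`;
      -- the swapped order makes it compare `v` with `y`.
      go (start uv refl b≡πv)  (start xy refl b≡πy)  =
        refl , π-inj S v∈B u∈B y∈B x∈B (H-sym uv) (H-sym xy) (trans (≡-sym b≡πv) b≡πy) refl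
      go (finish uv a≡πv refl) (finish xy a≡πy refl) =
        refl , π-inj S v∈B u∈B y∈B x∈B (H-sym uv) (H-sym xy) (trans (≡-sym a≡πv) a≡πy) refl
      go (start _ refl _)      (finish xy u≡πy _)    = ⊥-elim (B∌π u∈B y∈B x∈B (H-sym xy) u≡πy)
      go (finish _ _ refl)     (start xy _ u≡πy)     = ⊥-elim (B∌π u∈B y∈B x∈B (H-sym xy) u≡πy)
      go (start _ refl _)      (centre xy u≡πx _)    = ⊥-elim (B∌π u∈B x∈B y∈B xy u≡πx)
      go (finish _ _ refl)     (centre xy _ u≡πy)    = ⊥-elim (B∌π u∈B y∈B x∈B (H-sym xy) u≡πy)
      go (centre uv a≡πu _)    (start _ refl _)      = ⊥-elim (B∌π x∈B u∈B v∈B uv a≡πu)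
      go (centre uv _ b≡πv)    (finish _ _ refl)     = ⊥-elim (B∌π x∈B v∈B u∈B (H-sym uv) b≡πv)
      go (centre uv a≡πu b≡πv) (centre xy a≡πx b≡πy) =
        π-inj S u∈B v∈B x∈B y∈B uv xy πu≡πx πv≡πy ,
        π-inj S v∈B u∈B y∈B x∈B (H-sym uv) (H-sym xy) πv≡πy πu≡πx
        where
        πu≡πx = trans (≡-sym a≡πu) a≡πx
        πv≡πy = trans (≡-sym b≡πv) b≡πy

    edge-determines : ∀ {u v x y a b} → u ∈ B → v ∈ B → x ∈ B → y ∈ B →
      UsesEdge (path u v) a b → UsesEdge (path x y) a b → (u ≡ x × v ≡ y) ⊎ (u ≡ y × v ≡ x)
    edge-determines u∈B v∈B x∈B y∈B e e′ with uses e | uses e′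
    ... | inj₁ p | inj₁ q = inj₁ (uses-determines u∈B v∈B x∈B y∈B p q)
    ... | inj₁ p | inj₂ q = inj₂ (uses-determines u∈B v∈B y∈B x∈B p q)
    ... | inj₂ p | inj₁ q = let (v≡x , u≡y) = uses-determines v∈B u∈B x∈B y∈B p q in inj₂ (u≡y , v≡x)
    ... | inj₂ p | inj₂ q = let (v≡y , u≡x) = uses-determines v∈B u∈B y∈B x∈B p q in inj₁ (u≡x , v≡y)

    Scheme⇒immersion : ∀ k → k ≤ length B → StrongImmersionOfComplete G k
    Scheme⇒immersion k k≤ = ι , (λ i j → path (ι i) (ι j)) , (λ {i} {j} → ι-injective {i} {j}) ,
      (λ i j i<j → isPath (ι∈B i) (ι∈B j) (λ eq → <-irrefl (cong toℕ (ι-injective eq)) i<j)) ,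
      disjoint ,
      (λ i j w _ → internal (ι∈B i) (ι∈B j) (ι∈B w))
      where
      ι : Fin k → V
      ι i = lookup B (inject≤ i k≤)

      ι∈B : ∀ i → ι i ∈ B
      ι∈B i = ∈-lookup (inject≤ i k≤)

      ι-injective : ∀ {i j} → ι i ≡ ι j → i ≡ j
      ι-injective {i} {j} eq = inject≤-injective k≤ k≤ i j (lookup-injective (unique S) _ _ eq)

      disjoint : ∀ i j i′ j′ → toℕ i < toℕ j → toℕ i′ < toℕ j′ → ¬ (i ≡ i′ × j ≡ j′) →
        EdgeDisjoint (path (ι i) (ι j)) (path (ι i′) (ι j′))
      disjoint i j i′ j′ i<j i′<j′ distinct a b e e′
        with edge-determines (ι∈B i) (ι∈B j) (ι∈B i′) (ι∈B j′) e e′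
      ... | inj₁ (p , q) = distinct (ι-injective p , ι-injective q)
      -- The same pair in reverse order contradicts that both pairs of indices are increasing.
      ... | inj₂ (p , q) with ι-injective p | ι-injective q
      ...   | refl | refl = <-asym i<j i′<j′

-- From the homomorphism to the chromatic number.

module _ {n : ℕ} (G : Graph n) where
  open Covers G
  open Schemes G
  open Immersion G

  half-scheme-Andrasfai : ∀ d → ComplHomToAndrasfai G d → ∀ X → Unique X → HalfScheme X
  -- For `d = 0` truncated subtraction leaves the target without vertices, so `X` must be empty.
  half-scheme-Andrasfai zero (h , _) []      _ =
    [] , (λ v → v) , clique-scheme [] (λ ()) (λ ()) , z≤n
  half-scheme-Andrasfai zero (h , _) (x ∷ _) _ with () ← h x
  half-scheme-Andrasfai (suc e) (h , hom) =
    CircularOrder.half G e (3 * suc e ∸ 1)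
      {{>-nonZero (≤-trans (s≤s z≤n) (m≤n+m (suc e + (suc e + 0)) e))}}
      (cong (λ m → suc e + (suc e + m)) (+-identityʳ (suc e)))
      (toℕ ∘ h)
      λ uv → let (i , d≤i , i<2d , q , eq) = hom uv in
        i , d≤i , subst (i <_) (cong (suc e +_) (+-identityʳ (suc e))) i<2d , q , eq

theorem15 : ∀ {n : ℕ} (G : Graph n) → IndependenceNumberAtMost G 2 → (d : ℕ) → ComplHomToAndrasfai G d → (k : ℕ) → IsChromaticNumber G k → StrongImmersionOfComplete G k
theorem15 {n} G _ d hom k (_ , minimal) = Scheme⇒immersion scheme k (≤-trans (minimal size colouring) size≤)
  where
  open Covers G
  open Schemes G
  open Immersion G
  open Reduce (half-scheme-Andrasfai G d hom)

  vertices : Result (allFin n)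
  vertices = reduce (suc (length (allFin n))) (allFin n) ≤-refl (Unique.allFin⁺ n)
  open Result vertices

  -- By minimality of `k` this gives `k ≤ size`, so the scheme has at least `k` branch vertices.
  colouring : Colourable G size
  colouring = (λ v → colour size cover v (∈-allFin v)) ,
    λ {u} {v} uv → colour-proper size cover (∈-allFin u) (∈-allFin v) uv
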